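{- Let $U$ be a countably infinite set and let $\mathrm{G}$ be an oligomorphic subgroup of the symmetric group $\mathfrak{S}(U)$. Then there exists an order embedding of $(\mathcal{P}(\omega);\subseteq)$, the power set of $\omega$ ordered by inclusion, into $(\overline{\mathrm{G}}[U];\subseteq)$, the set of copies for $\mathrm{G}$ ordered by inclusion.
   Context: $U^U$ carries the function (product) topology, $U$ being discrete. $\overline{\mathrm{G}}$ denotes the closure of $\mathrm{G}$ in $U^U$: the set of maps $f:U\to U$ such that for every finite $F\subseteq U$ there is $g\in\mathrm{G}$ with $f|_F=g|_F$. The set of copies for $\mathrm{G}$ is $\overline{\mathrm{G}}[U]=\{f[U]\mid f\in\overline{\mathrm{G}}\}$. The group $\mathrm{G}$ is oligomorphic if for every $n\geq 1$ the induced action of $\mathrm{G}$ on $U^n$ has only finitely many orbits. -}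

module Defs where

open import Level using (0ℓ)
open import Data.Nat using (ℕ)
open import Data.Fin using (Fin)
open import Data.List using (List)
open import Data.List.Relation.Unary.Any using (Any)
open import Data.List.Relation.Unary.All using (All)
open import Data.Product using (Σ; ∃; _×_; _,_)
open import Function.Bundles using (_↔_; Inverse)
open import Function.Properties.Inverse using (↔-refl; ↔-sym; ↔-trans)
open import Relation.Binary.PropositionalEquality using (_≡_)
open import Relation.Unary using (Pred)

Perm : Set → Set
Perm U = U ↔ U

record IsSubgroup {U : Set} (G : Pred (Perm U) 0ℓ) : Set where
  field
    has-id  : G ↔-refl
    has-∘   : ∀ {g h} → G g → G h → G (↔-trans g h)
    has-inv : ∀ {g} → G g → G (↔-sym g)

Oligomorphic : {U : Set} → Pred (Perm U) 0ℓ → Set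
Oligomorphic {U} G =
  ∀ (n : ℕ) → ∃ λ (reps : List (Fin n → U)) →
    ∀ (t : Fin n → U) →
      Any (λ r → Σ (Perm U) λ g → G g × (∀ i → Inverse.to g (r i) ≡ t i)) reps

-- f lies in the closure of G in U^U (product topology, U discrete):
-- on every finite subset F ⊆ U, f agrees with some g ∈ G.
InClosure : {U : Set} → Pred (Perm U) 0ℓ → (U → U) → Set
InClosure {U} G f =
  ∀ (F : List U) → Σ (Perm U) λ g → G g × All (λ x → f x ≡ Inverse.to g x) F

Image : {U : Set} → (U → U) → Pred U 0ℓ
Image {U} f y = ∃ λ (x : U) → f x ≡ y

{-# OPTIONS --safe #-}

-- An Ehrenfeucht–Mostowski construction.  Terms over variables x₀, x₁, … are built from
-- Skolem functions for the orbits of G, and a sequence v in U evaluates them.  For finitely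
-- many terms, counting in a large finite box yields v such that no v n is the value of one
-- of these terms in the other variables.  As G is oligomorphic, a compactness argument makes
-- these evaluations converge, modulo G, to a single assignment ⟦_⟧ : Term U → U for which
-- ⟦ xₙ ⟧ is not the value of any term omitting xₙ.  The values of the terms over A ⊆ ℕ form
-- a set satisfying the Tarski–Vaught test, hence a copy by back-and-forth, and this copy
-- contains ⟦ xₙ ⟧ exactly when n ∈ A.

module Submission where

open import Defs
open import Level using (0ℓ)
open import Axiom.ExcludedMiddle using (ExcludedMiddle)
open import Data.Empty using (⊥-elim)
open import Data.Fin as Fin using (Fin; toℕ; fromℕ<)
open import Data.Fin.Properties using (toℕ-fromℕ<)
open import Data.List using (List; []; _∷_; length; map; upTo; cartesianProduct)
open import Data.List.Membership.Propositional using (_∈_)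
open import Data.List.Membership.Propositional.Properties using (∈-upTo⁺; ∈-cartesianProduct⁺)
open import Data.List.Relation.Unary.All as All using (All; []; _∷_)
import Data.List.Relation.Unary.All.Properties as All
open import Data.List.Relation.Unary.Any as Any using (Any; here; there)
import Data.List.Relation.Unary.Any.Properties as Any
open import Data.Nat using (ℕ; zero; suc; _+_; _*_; _^_; _≤_; _<_; z≤n; s≤s; _≟_; _≤?_; _⊔_)
open import Data.Nat.Properties
open import Data.Product using (Σ; ∃; _×_; _,_; proj₁; proj₂)
open import Data.Unit using (⊤; tt)
open import Function using (_∘_; _↔_; _⇔_; Inverse; mk⇔)
open import Function.Properties.Inverse using (↔-refl; ↔-sym; ↔-trans)
open import Relation.Binary.PropositionalEquality
open import Relation.Nullary using (¬_; yes; no)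
open import Relation.Nullary.Decidable using (decidable-stable)
open import Relation.Unary using (Pred; _⊆_)
open import Algebra.Properties.CommutativeMonoid.Sum +-0-commutativeMonoid
  using (sum; sum-cong-≗; ∑-distrib-+; ∑-comm; sum-replicate-zero)
open import Algebra.Properties.Semiring.Sum +-*-semiring using (*-distribˡ-sum)

-- Bounds for finite lists and updates of sequences

strict-bound : {A : Set} (f : A → ℕ) (xs : List A) → ∃ λ k → All (λ x → f x < k) xs
strict-bound f []       = 0 , []
strict-bound f (x ∷ xs) with strict-bound f xs
... | k , fxs<k = suc (f x) ⊔ k , m≤m⊔n (suc (f x)) k ∷ All.map (λ p → ≤-trans p (m≤n⊔m (suc (f x)) k)) fxs<k

module _ {A : Set} where

  _[_≔_] : (ℕ → A) → ℕ → A → ℕ → A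
  (v [ n ≔ x ]) m with m ≟ n
  ... | yes _ = x
  ... | no  _ = v m

  update-at : (v : ℕ → A) (n : ℕ) (x : A) → (v [ n ≔ x ]) n ≡ x
  update-at v n x with n ≟ n
  ... | yes _  = refl
  ... | no n≢n = ⊥-elim (n≢n refl)

  update-off : (v : ℕ → A) {m n : ℕ} (x : A) → m ≢ n → (v [ n ≔ x ]) m ≡ v m
  update-off v {m} {n} x m≢n with m ≟ n
  ... | yes m≡n = ⊥-elim (m≢n m≡n)
  ... | no  _   = refl

  update-cong : {v v′ : ℕ → A} (n : ℕ) (x : A) → v ≗ v′ → v [ n ≔ x ] ≗ v′ [ n ≔ x ]
  update-cong n x v≗v′ m with m ≟ n
  ... | yes _ = refl
  ... | no  _ = v≗v′ m

  update-comm : (v : ℕ → A) {k n : ℕ} (x y : A) → k ≢ n →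
                (v [ n ≔ x ]) [ k ≔ y ] ≗ (v [ k ≔ y ]) [ n ≔ x ]
  update-comm v {k} {n} x y k≢n m with m ≟ k | m ≟ n
  ... | yes m≡k | yes m≡n = ⊥-elim (k≢n (trans (sym m≡k) m≡n))
  ... | yes m≡k | no  _   rewrite m≡k = sym (update-at v k y)
  ... | no  _   | yes m≡n rewrite m≡n = update-at v n x
  ... | no m≢k  | no m≢n  = trans (update-off v x m≢n) (sym (update-off v y m≢k))

-- Counting in finite boxes

sum-≤ : ∀ {w c} (f : Fin w → ℕ) → (∀ i → f i ≤ c) → sum f ≤ w * c
sum-≤ {zero}  f f≤c = z≤n
sum-≤ {suc w} f f≤c = +-mono-≤ (f≤c Fin.zero) (sum-≤ (f ∘ Fin.suc) (f≤c ∘ Fin.suc))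

sum-average : ∀ {w c} (f : Fin w → ℕ) → sum f < w * c → ∃ λ i → f i < c
sum-average {suc w} {c} f ∑f<wc with c ≤? f Fin.zero
... | no  c≰f₀ = Fin.zero , ≰⇒> c≰f₀
... | yes c≤f₀ =
  let i , fᵢ<c = sum-average (f ∘ Fin.suc)
                   (+-cancelˡ-< c _ _ (≤-<-trans (+-monoˡ-≤ _ c≤f₀) ∑f<wc))
  in Fin.suc i , fᵢ<c

-- The Kronecker delta, which turns counting coincidences into summation.
δ : ℕ → ℕ → ℕ
δ zero    zero    = 1
δ zero    (suc _) = 0
δ (suc _) zero    = 0
δ (suc m) (suc n) = δ m n

δ-refl : ∀ n → δ n n ≡ 1
δ-refl zero    = refl
δ-refl (suc n) = δ-refl n

sum-δ≤1 : ∀ w c → sum {w} (λ i → δ (toℕ i) c) ≤ 1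
sum-δ≤1 zero    c       = z≤n
sum-δ≤1 (suc w) zero    = ≤-reflexive (cong suc (sum-replicate-zero w))
sum-δ≤1 (suc w) (suc c) = sum-δ≤1 w c

module Box (w : ℕ) where

  -- boxSum k P v sums P over the assignments with values below w at 0, …, k - 1 that agree
  -- with v elsewhere.
  boxSum : ℕ → ((ℕ → ℕ) → ℕ) → (ℕ → ℕ) → ℕ
  boxSum zero    P v = P v
  boxSum (suc k) P v = sum {w} λ i → boxSum k P (v [ k ≔ toℕ i ])

  boxSum-+ : ∀ k P Q v → boxSum k (λ u → P u + Q u) v ≡ boxSum k P v + boxSum k Q v
  boxSum-+ zero    P Q v = refl
  boxSum-+ (suc k) P Q v =
    trans (sum-cong-≗ {w} λ i → boxSum-+ k P Q (v [ k ≔ toℕ i ])) (∑-distrib-+ {w} _ _)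

  boxSum-0 : ∀ k v → boxSum k (λ _ → 0) v ≡ 0
  boxSum-0 zero    v = refl
  boxSum-0 (suc k) v = trans (sum-cong-≗ {w} λ i → boxSum-0 k (v [ k ≔ toℕ i ])) (sum-replicate-zero w)

  -- Updates at distinct places commute only pointwise, so sums have to be compared along `≗`.
  boxSum-cong : ∀ k {P v v′} → (∀ {u u′} → u ≗ u′ → P u ≡ P u′) → v ≗ v′ →
                boxSum k P v ≡ boxSum k P v′
  boxSum-cong zero    P-cong v≗v′ = P-cong v≗v′
  boxSum-cong (suc k) P-cong v≗v′ =
    sum-cong-≗ {w} λ i → boxSum-cong k P-cong (update-cong k (toℕ i) v≗v′)

  -- The box has `w ^ k` points, so a smaller total means an average below 1 and hence a zero.
  boxSum-average : ∀ k {P v} → boxSum k P v < w ^ k → ∃ λ u → P u ≡ 0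
  boxSum-average zero    {v = v} P<1 = v , n<1⇒n≡0 P<1
  boxSum-average (suc k) ∑<wᵏ = boxSum-average k (proj₂ (sum-average {w} _ ∑<wᵏ))

  module _ (n : ℕ) (h : (ℕ → ℕ) → ℕ)
           (h-indep : ∀ {u u′} → (∀ m → m ≢ n → u m ≡ u′ m) → h u ≡ h u′) where

    hit : (ℕ → ℕ) → ℕ
    hit u = δ (u n) (h u)

    hit-cong : ∀ {u u′} → u ≗ u′ → hit u ≡ hit u′
    hit-cong u≗u′ = cong₂ δ (u≗u′ n) (h-indep λ m _ → u≗u′ m)

    -- Along a line in direction `n` the target `h` is constant, so at most one point is a hit; the
    -- other `k` coordinates give `w ^ k` such lines. As `k ≤ n`, the sum over coordinate `n` can be
    -- moved innermost.
    boxSum-hit-line : ∀ k v → k ≤ n → sum {w} (λ i → boxSum k hit (v [ n ≔ toℕ i ])) ≤ w ^ k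
    boxSum-hit-line zero v _ = begin
      sum {w} (λ i → hit (v [ n ≔ toℕ i ]))
        ≡⟨ sum-cong-≗ {w} (λ i → cong₂ δ (update-at v n (toℕ i))
             (h-indep λ m → update-off v (toℕ i))) ⟩
      sum {w} (λ i → δ (toℕ i) (h v))
        ≤⟨ sum-δ≤1 w (h v) ⟩
      1 ∎
      where open ≤-Reasoning
    boxSum-hit-line (suc k) v k<n = begin
      sum {w} (λ i → sum {w} λ j → boxSum k hit ((v [ n ≔ toℕ i ]) [ k ≔ toℕ j ]))
        ≡⟨ ∑-comm {w} {w} _ ⟩
      sum {w} (λ j → sum {w} λ i → boxSum k hit ((v [ n ≔ toℕ i ]) [ k ≔ toℕ j ]))
        ≡⟨ sum-cong-≗ {w} (λ j → sum-cong-≗ {w} λ i →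
             boxSum-cong k hit-cong (update-comm v (toℕ i) (toℕ j) (<⇒≢ k<n))) ⟩
      sum {w} (λ j → sum {w} λ i → boxSum k hit ((v [ k ≔ toℕ j ]) [ n ≔ toℕ i ]))
        ≤⟨ sum-≤ {w} _ (λ j → boxSum-hit-line k (v [ k ≔ toℕ j ]) (<⇒≤ k<n)) ⟩
      w * w ^ k ∎
      where open ≤-Reasoning

    -- Hits have density at most 1 / `w`, stated free of division. Coordinates above `n` are peeled
    -- off until `n` is the outermost one, where `boxSum-hit-line` applies.
    boxSum-hit : ∀ k v → n < k → w * boxSum k hit v ≤ w ^ k
    boxSum-hit (suc k) v (s≤s n≤k) with n ≟ k
    ... | yes refl = *-monoʳ-≤ w (boxSum-hit-line n v ≤-refl)
    ... | no n≢k   = begin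
      w * sum {w} (λ i → boxSum k hit (v [ k ≔ toℕ i ]))
        ≡⟨ *-distribˡ-sum {w} w _ ⟩
      sum {w} (λ i → w * boxSum k hit (v [ k ≔ toℕ i ]))
        ≤⟨ sum-≤ {w} _ (λ i → boxSum-hit k (v [ k ≔ toℕ i ]) (≤∧≢⇒< n≤k n≢k)) ⟩
      w * w ^ k ∎
      where open ≤-Reasoning

module _ {C : Set} (pos : C → ℕ) (h : C → (ℕ → ℕ) → ℕ)
  (h-indep : ∀ c {u u′} → (∀ m → m ≢ pos c → u m ≡ u′ m) → h c u ≡ h c u′) where

  -- A constraint `c` forbids the value `h c u` at coordinate `pos c`; this counts the violations.
  hits : List C → (ℕ → ℕ) → ℕ
  hits []       u = 0
  hits (c ∷ cs) u = δ (u (pos c)) (h c u) + hits cs u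

  hits≡0⇒avoids : ∀ cs u → hits cs u ≡ 0 → All (λ c → u (pos c) ≢ h c u) cs
  hits≡0⇒avoids []       u _  = []
  hits≡0⇒avoids (c ∷ cs) u ≡0 =
    (λ hit → 1+n≢0 (trans (sym (δ-refl (h c u)))
                     (subst (λ z → δ z (h c u) ≡ 0) hit (m+n≡0⇒m≡0 _ ≡0))))
    ∷ hits≡0⇒avoids cs u (m+n≡0⇒n≡0 (δ (u (pos c)) (h c u)) ≡0)

  module _ (w : ℕ) where
    open Box w

    boxSum-hits : ∀ k v cs → All (λ c → pos c < k) cs →
                  w * boxSum k (hits cs) v ≤ length cs * w ^ k
    boxSum-hits k v []       []         = ≤-reflexive (trans (cong (w *_) (boxSum-0 k v)) (*-zeroʳ w))
    boxSum-hits k v (c ∷ cs) (c<k ∷ <k) = begin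
      w * boxSum k (hits (c ∷ cs)) v
        ≡⟨ cong (w *_) (boxSum-+ k _ (hits cs) v) ⟩
      w * (boxSum k (hit (pos c) (h c) (h-indep c)) v + boxSum k (hits cs) v)
        ≡⟨ *-distribˡ-+ w _ _ ⟩
      w * boxSum k (hit (pos c) (h c) (h-indep c)) v + w * boxSum k (hits cs) v
        ≤⟨ +-mono-≤ (boxSum-hit (pos c) (h c) (h-indep c) k v c<k) (boxSum-hits k v cs <k) ⟩
      w ^ k + length cs * w ^ k ∎
      where open ≤-Reasoning

  -- A union bound: each constraint is violated with density at most 1 / `w`, so once `w` exceeds
  -- the number of constraints the average number of violations is below 1.
  free-assignment : ∀ cs → ∃ λ u → All (λ c → u (pos c) ≢ h c u) cs
  free-assignment cs =
    let k , <k = strict-bound pos cs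
        w = suc (length cs)
        u , ≡0 = Box.boxSum-average w k {hits cs} {λ _ → 0}
          (*-cancelˡ-< w _ _ (≤-<-trans (boxSum-hits w k (λ _ → 0) cs <k)
            (m<n+m _ (m^n>0 w k))))
    in u , hits≡0⇒avoids cs u ≡0

-- Pairing of natural numbers

antidiagonal-step : ℕ × ℕ → ℕ × ℕ
antidiagonal-step (x , zero)  = 0 , suc x
antidiagonal-step (x , suc y) = suc x , y

unpair : ℕ → ℕ × ℕ
unpair zero    = 0 , 0
unpair (suc n) = antidiagonal-step (unpair n)

-- `unpair` walks through the antidiagonals in turn: `(x , y)` comes `x` steps after `(0 , x + y)`,
-- and `(0 , suc s)` right after `(s , 0)`.
unpair-surjective : ∀ x y → ∃ λ n → unpair n ≡ (x , y)
unpair-surjective x y = along x y (start (x + y))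
  where
  along : ∀ x y → (∃ λ n → unpair n ≡ (0 , x + y)) → ∃ λ n → unpair n ≡ (x , y)
  along zero    y p       = p
  along (suc x) y (n , p)
    with m , q ← along x (suc y) (n , trans p (cong (0 ,_) (sym (+-suc x y))))
    = suc m , cong antidiagonal-step q

  start : ∀ s → ∃ λ n → unpair n ≡ (0 , s)
  start zero    = 0 , refl
  start (suc s)
    with m , q ← along s 0 (subst (λ z → ∃ λ n → unpair n ≡ (0 , z)) (sym (+-identityʳ s)) (start s))
    = suc m , cong antidiagonal-step q

pair : ℕ → ℕ → ℕ
pair x y = proj₁ (unpair-surjective x y)

pair-injective : ∀ {x y x′ y′} → pair x y ≡ pair x′ y′ → x ≡ x′ × y ≡ y′
pair-injective {x} {y} {x′} {y′} eq = cong proj₁ xy≡x′y′ , cong proj₂ xy≡x′y′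
  where
  xy≡x′y′ : (x , y) ≡ (x′ , y′)
  xy≡x′y′ = trans (sym (proj₂ (unpair-surjective x y)))
                  (trans (cong unpair eq) (proj₂ (unpair-surjective x′ y′)))

-- Skolem terms and their codes

-- wit ((c₁ , t₁) ∷ … ∷ (cₙ , tₙ) ∷ []) u is a Skolem term: it denotes some g · u with g in G
-- taking each cᵢ to the value of tᵢ, and the junk value u if there is no such g.
data Term (U : Set) : Set where
  var : ℕ → Term U
  wit : List (U × Term U) → U → Term U

data Over {U : Set} (A : Pred ℕ 0ℓ) : Term U → Set where
  var : ∀ {n} → A n → Over A (var n)
  wit : ∀ {as u} → All (λ a → Over A (proj₂ a)) as → Over A (wit as u)

module _ {U : Set} {A B : Pred ℕ 0ℓ} (A⊆B : A ⊆ B) where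
  mutual
    over-mono : {t : Term U} → Over A t → Over B t
    over-mono (var n∈A) = var (A⊆B n∈A)
    over-mono (wit as)  = wit (over-mono* as)

    over-mono* : {as : List (U × Term U)} → All (λ a → Over A (proj₂ a)) as →
                 All (λ a → Over B (proj₂ a)) as
    over-mono* []       = []
    over-mono* (t ∷ as) = over-mono t ∷ over-mono* as

mutual
  -- With every variable allowed, `ev-cong` becomes applicable to an arbitrary term.
  over-universal : {U : Set} (t : Term U) → Over (λ _ → ⊤) t
  over-universal (var n)    = var tt
  over-universal (wit as u) = wit (over-universal* as)

  over-universal* : {U : Set} (as : List (U × Term U)) → All (λ a → Over (λ _ → ⊤) (proj₂ a)) as
  over-universal* []             = []
  over-universal* ((_ , t) ∷ as) = over-universal t ∷ over-universal* as

module Coding {U : Set} (em : ExcludedMiddle 0ℓ) (index : U → ℕ)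
  (index-injective : ∀ {x y} → index x ≡ index y → x ≡ y) where

  mutual
    code : Term U → ℕ
    code (var n)    = pair 0 n
    code (wit as u) = pair (suc (code* as)) (index u)

    code* : List (U × Term U) → ℕ
    code* []             = 0
    code* ((c , t) ∷ as) = suc (pair (pair (index c) (code t)) (code* as))

  mutual
    code-injective : ∀ s t → code s ≡ code t → s ≡ t
    code-injective (var m)    (var n)    eq = cong var (proj₂ (pair-injective {0} {m} {0} {n} eq))
    code-injective (var m)    (wit bs w) eq
      with () ← proj₁ (pair-injective {0} {m} {suc (code* bs)} {index w} eq)
    code-injective (wit as u) (var n)    eq
      with () ← proj₁ (pair-injective {suc (code* as)} {index u} {0} {n} eq)
    code-injective (wit as u) (wit bs w) eq
      with p , q ← pair-injective {suc (code* as)} {index u} {suc (code* bs)} {index w} eq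
      = cong₂ wit (code*-injective as bs (suc-injective p)) (index-injective q)

    code*-injective : ∀ as bs → code* as ≡ code* bs → as ≡ bs
    code*-injective []             []             eq = refl
    code*-injective ((c , s) ∷ as) ((d , t) ∷ bs) eq
      with p , q ← pair-injective {pair (index c) (code s)} {code* as}
                                  {pair (index d) (code t)} {code* bs} (suc-injective eq)
      with r , z ← pair-injective {index c} {code s} {index d} {code t} p
      = cong₂ _∷_ (cong₂ _,_ (index-injective r) (code-injective s t z)) (code*-injective as bs q)

  enum : ℕ → Term U
  enum n with em {∃ λ t → code t ≡ n}
  ... | yes (t , _) = t
  -- A default for numbers that code no term; `enum-code` meets only genuine codes.
  ... | no  _       = var 0

  enum-code : ∀ t → enum (code t) ≡ t
  enum-code t with em {∃ λ s → code s ≡ code t}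
  ... | yes (s , eq) = code-injective s t eq
  ... | no  ∄s       = ⊥-elim (∄s (t , refl))

-- Compactness modulo an oligomorphic group

-- If the head fails at level `k₀`, antitonicity makes it fail at all later levels, so the witness
-- at level `k ⊔ k₀` lies in the tail and descends to level `k`.
pigeonhole : ExcludedMiddle 0ℓ → {A : Set} (Q : A → ℕ → Set) →
             (∀ {x k l} → k ≤ l → Q x l → Q x k) →
             ∀ xs → (∀ k → Any (λ x → Q x k) xs) → Any (λ x → ∀ k → Q x k) xs
pigeonhole em Q Q-anti []       any with () ← any 0
pigeonhole em Q Q-anti (x ∷ xs) any with em {∃ λ k → ¬ Q x k}
... | no  ∄k         = here λ k → decidable-stable em λ ¬q → ∄k (k , ¬q)
... | yes (k₀ , ¬q₀) = there (pigeonhole em Q Q-anti xs λ k → tail k (any (k ⊔ k₀)))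
  where
  tail : ∀ k → Any (λ y → Q y (k ⊔ k₀)) (x ∷ xs) → Any (λ y → Q y k) xs
  tail k (here q)  = ⊥-elim (¬q₀ (Q-anti (m≤n⊔m k k₀) q))
  tail k (there p) = Any.map (Q-anti (m≤m⊔n k k₀)) p

infixr 5 _·_
_·_ : {U : Set} → Perm U → U → U
_·_ = Inverse.to

module Group {U : Set} (em : ExcludedMiddle 0ℓ) (bij : ℕ ↔ U)
  (G : Pred (Perm U) 0ℓ) (sub : IsSubgroup G) where

  open IsSubgroup sub
  open Inverse bij using () renaming
    (to to elem; from to index; strictlyInverseˡ to elem-index; strictlyInverseʳ to index-elem)

  ·-sym : (g : Perm U) {x y : U} → g · x ≡ y → ↔-sym g · y ≡ x
  ·-sym g refl = Inverse.strictlyInverseʳ g _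

  module Limit (olig : Oligomorphic G) where

    -- Let `g` take a representative `r` to `u` followed by the first `n` entries of `p`, and let
    -- `h` be the element that `rep` selects for `r`. Then `h` after the inverse of `g` fixes these
    -- entries and takes `u` to `rep r`, which depends on `r` alone.
    stabilizer-orbits : ∀ n (p : ℕ → U) → ∃ λ (us : List U) → ∀ u →
      Any (λ u′ → ∃ λ g → G g × (∀ i → i < n → g · p i ≡ p i) × g · u ≡ u′) us
    stabilizer-orbits n p = map rep reps , λ u → Any.map⁺ (Any.map (fix u) (cover (tuple u)))
      where
      reps  = proj₁ (olig (suc n))
      cover = proj₂ (olig (suc n))

      tuple : U → Fin (suc n) → U
      tuple u Fin.zero    = u
      tuple u (Fin.suc i) = p (toℕ i)

      Over-p : (Fin (suc n) → U) → Set
      Over-p r = ∃ λ h → G h × (∀ i → h · r (Fin.suc i) ≡ p (toℕ i))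

      rep : (Fin (suc n) → U) → U
      rep r with em {Over-p r}
      ... | yes (h , _) = h · r Fin.zero
      -- Such an `r` represents no tuple ending in the entries of `p`, so `fix` refutes this case.
      ... | no  _       = r Fin.zero

      fix : ∀ u {r} → Σ (Perm U) (λ g → G g × (∀ i → g · r i ≡ tuple u i)) →
            ∃ λ g → G g × (∀ i → i < n → g · p i ≡ p i) × g · u ≡ rep r
      fix u {r} (g , Gg , g·r≡) with em {Over-p r}
      ... | no ∄h = ⊥-elim (∄h (g , Gg , g·r≡ ∘ Fin.suc))
      ... | yes (h , Gh , h·r≡) =
        ↔-trans (↔-sym g) h , has-∘ (has-inv Gg) Gh ,
        (λ i i<n → subst (λ j → h · ↔-sym g · p j ≡ p j) (toℕ-fromℕ< i<n)
          (trans (cong (h ·_) (·-sym g (g·r≡ (Fin.suc (fromℕ< i<n))))) (h·r≡ (fromℕ< i<n)))) ,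
        cong (h ·_) (·-sym g (g·r≡ Fin.zero))

    module _ {V : Set} (a : V → ℕ → U) (K : ℕ → V → Set)
      (K-anti : ∀ {k l v} → k ≤ l → K l v → K k v) (K-inhabited : ∀ k → ∃ (K k)) where

      Approx : ℕ → ℕ → (ℕ → U) → Set
      Approx n k p = ∃ λ v → K k v × ∃ λ g → G g × (∀ i → i < n → g · a v i ≡ p i)

      -- At each level `k` the next entry can be moved into one finite list by an element fixing the
      -- first `n` entries of `p`. `pigeonhole` picks from that list an entry that serves all
      -- levels.
      extend : ∀ n p → (∀ k → Approx n k p) → ∃ λ u → ∀ k → Approx (suc n) k (p [ n ≔ u ])
      extend n p good =
        let us , cover = stabilizer-orbits n p in
        Any.satisfied (pigeonhole em (λ u k → Approx (suc n) k (p [ n ≔ u ]))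
          (λ { k≤l (v , Kv , rest) → v , K-anti k≤l Kv , rest }) us
          λ k → let v , Kv , g , Gg , g·a≡p = good k in
                Any.map (λ { {u′} (h , Gh , h·p≡p , h·u≡u′) →
                  v , Kv , ↔-trans g h , has-∘ Gg Gh , λ i i<1+n →
                    lemma v g h u′ g·a≡p h·p≡p h·u≡u′ i i<1+n })
                  (cover (g · a v n)))
        where
        lemma : ∀ v g h u′ → (∀ i → i < n → g · a v i ≡ p i) → (∀ i → i < n → h · p i ≡ p i) →
                h · g · a v n ≡ u′ → ∀ i → i < suc n → h · g · a v i ≡ (p [ n ≔ u′ ]) i
        lemma v g h u′ g·a≡p h·p≡p h·u≡u′ i (s≤s i≤n) with i ≟ n
        ... | yes refl = h·u≡u′
        ... | no  i≢n  = trans (cong (h ·_) (g·a≡p i (≤∧≢⇒< i≤n i≢n))) (h·p≡p i (≤∧≢⇒< i≤n i≢n))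

      approx : ∀ n → ∃ λ p → ∀ k → Approx n k p
      approx zero    = (λ _ → elem 0) , λ k →
        let v , Kv = K-inhabited k in v , Kv , ↔-refl , has-id , λ _ ()
      approx (suc n) =
        let p , good  = approx n
            u , good′ = extend n p good
        in p [ n ≔ u ] , good′

      -- Stage `suc i` is the one that sets entry `i`; later stages leave it alone.
      limit : ℕ → U
      limit i = proj₁ (approx (suc i)) i

      approx-limit : ∀ n i → i < n → proj₁ (approx n) i ≡ limit i
      approx-limit (suc n) i (s≤s i≤n) with i ≟ n
      ... | yes refl = sym (update-at (proj₁ (approx n)) n _)
      ... | no  i≢n  = approx-limit n i (≤∧≢⇒< i≤n i≢n)

      limit-approx : ∀ k → ∃ λ v → K k v × ∃ λ g → G g × (∀ i → i < k → g · a v i ≡ limit i)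
      limit-approx k =
        let v , Kv , g , Gg , g·a≡p = proj₂ (approx k) k
        in v , Kv , g , Gg , λ i i<k → trans (g·a≡p i i<k) (approx-limit k i i<k)

  -- Copies by back-and-forth

  -- For the canonical structure of G this says that X is an elementary substructure.
  TarskiVaught : Pred U 0ℓ → Set
  TarskiVaught X = ∀ b → All X b → ∀ u → ∃ λ g → G g × All (λ x → g · x ≡ x) b × X (g · u)

  module BackAndForth (X : Pred U 0ℓ) (tv : TarskiVaught X) where

    -- A finite partial map into `X`, carried by a total permutation in `G` so that limits of such
    -- maps lie in the closure. Only the values on `dom` are preserved by `⊑`.
    record Partial : Set where
      field
        perm   : Perm U
        perm∈G : G perm
        dom    : List U
        maps   : All (λ x → X (perm · x)) dom

    open Partial

    _⊑_ : Partial → Partial → Set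
    s ⊑ s′ = ∀ {x} → x ∈ dom s → x ∈ dom s′ × perm s′ · x ≡ perm s · x

    ⊑-trans : ∀ {s s′ s″} → s ⊑ s′ → s′ ⊑ s″ → s ⊑ s″
    ⊑-trans p q x∈ = let x∈′ , eq = p x∈ ; x∈″ , eq′ = q x∈′ in x∈″ , trans eq′ eq

    forth : ∀ x s → ∃ λ s′ → s ⊑ s′ × x ∈ dom s′
    forth x s =
      -- `h` fixes the images of `dom s`, so composing with it keeps the values there while taking
      -- the image of `x` into `X`.
      let h , Gh , fixes , Xhx = tv (map (perm s ·_) (dom s)) (All.map⁺ (maps s)) (perm s · x)
          fixes′ = All.map⁻ fixes
      in record
           { perm   = ↔-trans (perm s) h
           ; perm∈G = has-∘ (perm∈G s) Gh
           ; dom    = x ∷ dom s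
           ; maps   = Xhx ∷ All.zipWith (λ { (eq , Xx) → subst X (sym eq) Xx }) (fixes′ , maps s)
           }
         , (λ y∈ → there y∈ , All.lookup fixes′ y∈)
         , here refl

    -- The permutation is already onto, so it stays the same and the preimage of `y` merely joins
    -- the domain.
    back : ∀ y s → ∃ λ s′ → s ⊑ s′ × (X y → ∃ λ x → x ∈ dom s′ × perm s′ · x ≡ y)
    back y s with em {X y}
    ... | no ¬Xy = s , (λ x∈ → x∈ , refl) , λ Xy → ⊥-elim (¬Xy Xy)
    ... | yes Xy =
      record
        { perm   = perm s
        ; perm∈G = perm∈G s
        ; dom    = (↔-sym (perm s) · y) ∷ dom s
        ; maps   = subst X (sym (Inverse.strictlyInverseˡ (perm s) y)) Xy ∷ maps s
        }
      , (λ x∈ → there x∈ , refl)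
      , λ _ → _ , here refl , Inverse.strictlyInverseˡ (perm s) y

    stage : ℕ → Partial
    stage zero    = record { perm = ↔-refl ; perm∈G = has-id ; dom = [] ; maps = [] }
    stage (suc n) = proj₁ (back (elem n) (proj₁ (forth (elem n) (stage n))))

    stage-step : ∀ n → stage n ⊑ stage (suc n)
    stage-step n =
      let s , p , _ = forth (elem n) (stage n)
          s′ , q , _ = back (elem n) s
      in ⊑-trans {stage n} {s} {s′} p q

    stage-mono : ∀ {m} n → m ≤ n → stage m ⊑ stage n
    stage-mono {m} n m≤n with m ≟ n
    ... | yes refl = λ x∈ → x∈ , refl
    stage-mono zero    z≤n | no 0≢0 = ⊥-elim (0≢0 refl)
    stage-mono {m} (suc n) m≤1+n | no m≢1+n =
      ⊑-trans {stage m} {stage n} {stage (suc n)}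
        (stage-mono n (≤-pred (≤∧≢⇒< m≤1+n m≢1+n))) (stage-step n)

    -- `elem n` is treated in the step from stage `n` to stage `suc n`, hence the `suc`.
    stage-dom : ∀ x → x ∈ dom (stage (suc (index x)))
    stage-dom x =
      let s , _ , x∈ = forth (elem (index x)) (stage (index x))
          _ , q , _  = back (elem (index x)) s
      in subst (_∈ dom (stage (suc (index x)))) (elem-index x) (proj₁ (q x∈))

    stage-range : ∀ {y} → X y → ∃ λ x → x ∈ dom (stage (suc (index y))) × perm (stage (suc (index y))) · x ≡ y
    stage-range {y} Xy =
      let s , _      = forth (elem (index y)) (stage (index y))
          _ , _ , r  = back (elem (index y)) s
          x , x∈ , eq = r (subst X (sym (elem-index y)) Xy)
      in x , x∈ , trans eq (elem-index y)

    copy : U → U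
    copy x = perm (stage (suc (index x))) · x

    copy-stage : ∀ n {x} → x ∈ dom (stage n) → copy x ≡ perm (stage n) · x
    copy-stage n {x} x∈ =
      let m = suc (index x)
          _ , eq  = stage-mono (m ⊔ n) (m≤m⊔n m n) (stage-dom x)
          _ , eq′ = stage-mono (m ⊔ n) (m≤n⊔m m n) x∈
      in trans (sym eq) eq′

    copy∈closure : InClosure G copy
    copy∈closure F =
      let k , F<k = strict-bound index F
      -- By stage `k` all of `F` has entered the domain, so the values there are final.
      in perm (stage k) , perm∈G (stage k) ,
         All.map (λ {x} x<k → copy-stage k (proj₁ (stage-mono k x<k (stage-dom x)))) F<k

    image⊆X : Image copy ⊆ X
    image⊆X (x , refl) = All.lookup (maps (stage (suc (index x)))) (stage-dom x)

    X⊆image : X ⊆ Image copy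
    X⊆image {y} Xy =
      let x , x∈ , eq = stage-range Xy
      in x , trans (copy-stage (suc (index y)) x∈) eq

  TarskiVaught⇒copy : ∀ X → TarskiVaught X →
                      ∃ λ f → InClosure G f × Image f ⊆ X × X ⊆ Image f
  TarskiVaught⇒copy X tv = copy , copy∈closure , image⊆X , X⊆image
    where open BackAndForth X tv

  -- Evaluation of Skolem terms and free sequences

  open Coding em index (λ {x} {y} eq → trans (sym (elem-index x)) (trans (cong elem eq) (elem-index y)))

  Matches : Perm U → List (U × U) → Set
  Matches g = All λ cb → g · proj₁ cb ≡ proj₂ cb

  choose : List (U × U) → U → U
  choose ps u with em {∃ λ g → G g × Matches g ps}
  ... | yes (g , _) = g · u
  ... | no  _       = u

  -- The given `g` excludes the default case of `choose`.
  choose-spec : ∀ {ps} u g → G g → Matches g ps →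
                ∃ λ h → G h × Matches h ps × h · u ≡ choose ps u
  choose-spec {ps} u g Gg gps with em {∃ λ g → G g × Matches g ps}
  ... | yes (h , Gh , hps) = h , Gh , hps , refl
  ... | no  ∄h             = ⊥-elim (∄h (g , Gg , gps))

  mutual
    ev : (ℕ → U) → Term U → U
    ev v (var n)    = v n
    ev v (wit as u) = choose (ev* v as) u

    ev* : (ℕ → U) → List (U × Term U) → List (U × U)
    ev* v []             = []
    ev* v ((c , t) ∷ as) = (c , ev v t) ∷ ev* v as

  ev*-map : ∀ v as → ev* v as ≡ map (λ a → proj₁ a , ev v (proj₂ a)) as
  ev*-map v []       = refl
  ev*-map v (a ∷ as) = cong (_ ∷_) (ev*-map v as)

  -- The inverse of `g` takes each constant to the value of its term, so `choose` yields an `h` in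
  -- `G` doing the same, with `h · u` the value of the Skolem term. Then `g` after `h` fixes the
  -- constants.
  wit-realised : ∀ as u v g → G g → All (λ a → g · ev v (proj₂ a) ≡ proj₁ a) as →
                  ∃ λ g′ → G g′ × All (λ a → g′ · proj₁ a ≡ proj₁ a) as ×
                           g′ · u ≡ g · ev v (wit as u)
  wit-realised as u v g Gg g·as =
    let h , Gh , h-matches , h·u≡ = choose-spec u (↔-sym g) (has-inv Gg)
          (subst (Matches (↔-sym g)) (sym (ev*-map v as)) (All.map⁺ (All.map (·-sym g) g·as)))
    in ↔-trans h g , has-∘ Gh Gg ,
       All.zipWith (λ { (h·c≡ , g·≡c) → trans (cong (g ·_) h·c≡) g·≡c })
         (All.map⁻ (subst (Matches h) (ev*-map v as) h-matches) , g·as) ,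
       cong (g ·_) h·u≡

  module _ {A : Pred ℕ 0ℓ} {v v′ : ℕ → U} (v≡v′ : ∀ n → A n → v n ≡ v′ n) where
    mutual
      ev-cong : ∀ {t} → Over A t → ev v t ≡ ev v′ t
      ev-cong (var n∈A)        = v≡v′ _ n∈A
      ev-cong (wit {u = u} as) = cong (λ ps → choose ps u) (ev*-cong as)

      ev*-cong : ∀ {as} → All (λ a → Over A (proj₂ a)) as → ev* v as ≡ ev* v′ as
      ev*-cong []       = refl
      ev*-cong (t ∷ as) = cong₂ _∷_ (cong (_ ,_) (ev-cong t)) (ev*-cong as)

  -- Bounding both `n` and `code t` by `k` leaves finitely many conditions.
  Free : ℕ → (ℕ → U) → Set
  Free k v = ∀ n t → n < k → code t < k → Over (_≢ n) t → v n ≢ ev v t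

  -- Transported along `index`, the conditions become constraints on sequences of numbers, one for
  -- each pair below `k`, and `free-assignment` meets them all at once.
  free-exists : ∀ k → ∃ (Free k)
  free-exists k = elem ∘ u , λ n t n<k t<k n∉t vn≡t →
    All.lookup avoids (∈-cartesianProduct⁺ (∈-upTo⁺ n<k) (∈-upTo⁺ t<k))
      (trans (sym (index-elem (u n))) (cong index (trans vn≡t (begin
        ev (elem ∘ u) t
          -- `t` omits variable `n`, so resetting that coordinate keeps its value.
          ≡⟨ ev-cong (λ m m≢n → cong elem (sym (update-off u 0 m≢n))) n∉t ⟩
        ev (elem ∘ (u [ n ≔ 0 ])) t
          ≡⟨ cong (ev _) (enum-code t) ⟨
        ev (elem ∘ (u [ n ≔ 0 ])) (enum (code t)) ∎))))
    where
    open ≡-Reasoning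

    -- Resetting coordinate n makes this independent of it even for terms that mention xₙ.
    value : ℕ × ℕ → (ℕ → ℕ) → ℕ
    value (n , i) u = index (ev (elem ∘ (u [ n ≔ 0 ])) (enum i))

    value-indep : ∀ c {u u′} → (∀ m → m ≢ proj₁ c → u m ≡ u′ m) → value c u ≡ value c u′
    value-indep (n , i) {u} {u′} u≡u′ =
      cong index (ev-cong (λ m _ → cong elem (agree m)) (over-universal (enum i)))
      where
      agree : ∀ m → (u [ n ≔ 0 ]) m ≡ (u′ [ n ≔ 0 ]) m
      agree m with m ≟ n
      ... | yes _  = refl
      ... | no m≢n = u≡u′ m m≢n

    solution = free-assignment proj₁ value value-indep (cartesianProduct (upTo k) (upTo k))
    u        = proj₁ solution
    avoids   = proj₂ solution

  -- Hulls of sets of variables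

  module Hull (olig : Oligomorphic G) where

    private
      values : (ℕ → U) → ℕ → U
      values v i = ev v (enum i)

      Free-anti : ∀ {k l v} → k ≤ l → Free l v → Free k v
      Free-anti k≤l free n t n<k t<k = free n t (≤-trans n<k k≤l) (≤-trans t<k k≤l)

    abstract
      ⟦_⟧ : Term U → U
      ⟦ t ⟧ = Limit.limit olig values Free Free-anti free-exists (code t)

      -- Later facts about the limit rest on this: below any code bound it is a translate by `G` of
      -- evaluation at a sufficiently free sequence.
      ⟦⟧-approx : ∀ k → ∃ λ v → Free k v × ∃ λ g → G g × (∀ t → code t < k → g · ev v t ≡ ⟦ t ⟧)
      ⟦⟧-approx k =
        let v , free , g , Gg , g·≡ = Limit.limit-approx olig values Free Free-anti free-exists k
        in v , free , g , Gg ,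
           λ t t<k → trans (cong (λ s → g · ev v s) (sym (enum-code t))) (g·≡ (code t) t<k)

    -- At a level beyond `n` and both codes, an equality in the limit pulls back along `g` to
    -- `v n ≡ ev v t`, which freeness of `v` rules out.
    ⟦var⟧-free : ∀ {n t} → Over (_≢ n) t → ⟦ var n ⟧ ≢ ⟦ t ⟧
    ⟦var⟧-free {n} {t} n∉t eq =
      let k = suc (n + (code (var n) + code t))
          v , free , g , _ , g·≡ = ⟦⟧-approx k
          n<k = s≤s (m≤m+n n _)
          x<k = s≤s (≤-trans (m≤m+n _ (code t)) (m≤n+m _ n))
          t<k = s≤s (≤-trans (m≤n+m (code t) (code (var n))) (m≤n+m _ n))
      in free n t n<k t<k n∉t (begin
        v n                        ≡⟨ ·-sym g refl ⟨
        ↔-sym g · g · v n          ≡⟨ cong (↔-sym g ·_) (g·≡ (var n) x<k) ⟩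
        ↔-sym g · ⟦ var n ⟧        ≡⟨ cong (↔-sym g ·_) eq ⟩
        ↔-sym g · ⟦ t ⟧            ≡⟨ ·-sym g (g·≡ t t<k) ⟩
        ev v t                     ∎)
      where open ≡-Reasoning

    hull : Pred ℕ 0ℓ → Pred U 0ℓ
    hull A x = ∃ λ t → Over A t × ⟦ t ⟧ ≡ x

    -- Elements paired with terms are the form in which `wit` takes its arguments.
    names : ∀ {A} b → All (hull A) b → ∃ λ as →
            All (λ a → Over A (proj₂ a)) as × All (λ a → ⟦ proj₂ a ⟧ ≡ proj₁ a) as × map proj₁ as ≡ b
    names []      []                    = [] , [] , [] , refl
    names (x ∷ b) ((t , At , t≡x) ∷ ts) =
      let as , Aas , as≡ , eq = names b ts
      in (x , t) ∷ as , At ∷ Aas , t≡x ∷ as≡ , cong (x ∷_) eq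

    -- A level beyond the codes of the Skolem term and of all its arguments lets one `v` and one `g`
    -- serve them all.
    ⟦⟧-approx* : ∀ as u → All (λ a → ⟦ proj₂ a ⟧ ≡ proj₁ a) as →
                 ∃ λ v → ∃ λ g → G g × All (λ a → g · ev v (proj₂ a) ≡ proj₁ a) as ×
                                 g · ev v (wit as u) ≡ ⟦ wit as u ⟧
    ⟦⟧-approx* as u as≡ with strict-bound (λ a → code (proj₂ a)) as
    ... | k , as<k = extract (⟦⟧-approx (m ⊔ k))
      where
      m : ℕ
      m = suc (code (wit as u))

      extract : (∃ λ v → Free (m ⊔ k) v × ∃ λ g → G g × (∀ t → code t < m ⊔ k → g · ev v t ≡ ⟦ t ⟧)) →
                ∃ λ v → ∃ λ g → G g × All (λ a → g · ev v (proj₂ a) ≡ proj₁ a) as ×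
                                g · ev v (wit as u) ≡ ⟦ wit as u ⟧
      extract (v , _ , g , Gg , g·≡) =
        v , g , Gg ,
        All.zipWith (λ {a} p → trans (g·≡ (proj₂ a) (≤-trans (proj₁ p) (m≤n⊔m m k))) (proj₂ p))
          (as<k , as≡) ,
        g·≡ (wit as u) (m≤m⊔n m k)

    -- The Skolem term built from `u` and names of the elements of `b` is again over `A`, and some
    -- `g′` in `G` fixes `b` and sends `u` to its value.
    hull-TarskiVaught : ∀ A → TarskiVaught (hull A)
    hull-TarskiVaught A b Xb u =
      let as , Aas , as≡ , as↦b          = names b Xb
          v , g , Gg , g·as , g·w≡       = ⟦⟧-approx* as u as≡
          g′ , Gg′ , g′-fixes , g′·u≡g·w = wit-realised as u v g Gg g·as
      in g′ , Gg′ , subst (All λ x → g′ · x ≡ x) as↦b (All.map⁺ g′-fixes) ,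
         (wit as u , wit Aas , sym (trans g′·u≡g·w g·w≡))

    hull-mono : ∀ {A B} → A ⊆ B → hull A ⊆ hull B
    hull-mono A⊆B (t , At , t≡x) = t , over-mono A⊆B At , t≡x

    -- The element `⟦ var n ⟧` of `hull A` is also the value of a term over `B`. If `n` were outside
    -- `B`, this term would omit variable `n`, against `⟦var⟧-free`.
    hull-reflects : ∀ {A B} → hull A ⊆ hull B → A ⊆ B
    hull-reflects hA⊆hB {n} n∈A = decidable-stable em λ n∉B →
      let t , Bt , t≡ = hA⊆hB (var n , var n∈A , refl)
      in ⟦var⟧-free (over-mono (λ { m∈B refl → n∉B m∈B }) Bt) (sym t≡)

-- The order embedding

theorem10p2 : ExcludedMiddle 0ℓ →
    (U : Set) → ℕ ↔ U →
    (G : Pred (Perm U) 0ℓ) → IsSubgroup G → Oligomorphic G →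
    Σ (Pred ℕ 0ℓ → (U → U)) λ φ →
    (∀ A → InClosure G (φ A)) ×
    (∀ (A B : Pred ℕ 0ℓ) → (A ⊆ B) ⇔ (Image (φ A) ⊆ Image (φ B)))
theorem10p2 em U bij G sub olig =
  -- The image of the map chosen for `A` is exactly `hull A`, so inclusions of images are inclusions
  -- of hulls.
  (λ A → proj₁ (copy A)) , (λ A → proj₁ (proj₂ (copy A))) , λ A B → mk⇔ (monotone A B) (reflecting A B)
  where
  open Group em bij G sub
  open Hull olig

  copy : ∀ A → ∃ λ f → InClosure G f × Image f ⊆ hull A × hull A ⊆ Image f
  copy A = TarskiVaught⇒copy (hull A) (hull-TarskiVaught A)

  into : ∀ A → Image (proj₁ (copy A)) ⊆ hull A
  into A = proj₁ (proj₂ (proj₂ (copy A)))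

  onto : ∀ A → hull A ⊆ Image (proj₁ (copy A))
  onto A = proj₂ (proj₂ (proj₂ (copy A)))

  monotone : ∀ A B → A ⊆ B → Image (proj₁ (copy A)) ⊆ Image (proj₁ (copy B))
  monotone A B A⊆B y∈ = onto B (hull-mono {A} {B} A⊆B (into A y∈))

  reflecting : ∀ A B → Image (proj₁ (copy A)) ⊆ Image (proj₁ (copy B)) → A ⊆ B
  reflecting A B φA⊆φB = hull-reflects {A} {B} λ x∈ → into B (φA⊆φB (onto A x∈))
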